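{- Let $\mathcal{C}_0$ and $\mathcal{C}$ be ind-closed categories and let $I:\mathcal{C}_0\to\mathcal{C}$, $F:\mathcal{C}\to\mathcal{C}_0$ be an internal cover of $\mathcal{C}_0$ (that is, $I$ and $F$ are closed functors and $F\circ I$ is identified with the identity functor of $\mathcal{C}_0$). Then for every left-exact functor $H:\mathcal{C}_0\to\mathcal{D}$, the map of groups $$\mathrm{Aut}(H\circ F/I)\to\mathrm{Aut}(\Gamma_{\mathcal{D}}\circ H\circ F/I)$$ obtained by applying $\Gamma_{\mathcal{D}}$ is an isomorphism.
   Context: Categories are essentially small (except for the categories $\mathrm{Ind}$ built from them) and have all finite (inverse) limits; $\mathbf{1}$ is the terminal object. $\mathrm{Ind}(\mathcal{C})$ is the usual category of ind-objects (formal filtered colimits); functors are extended to ind-objects termwise. Left-exact means preserving finite limits. For objects $X,Y$ of $\mathcal{C}$, $\underline{Hom}(X,Y)$ is the presheaf $Z\mapsto Hom(Z\times X,Y)$ on $\mathcal{C}$. The category $\mathcal{C}$ is ind-closed if it has finite limits and $\underline{Hom}(X,Y)$ is representable by an ind-object for all objects $X,Y$; there is then an evaluation map $\underline{Hom}(X,Y)\times X\to Y$ in $\mathrm{Ind}(\mathcal{C})$. A functor $F:\mathcal{C}\to\mathcal{D}$ with $\mathcal{C}$ ind-closed is closed if it preserves finite limits and, for all $X,Y$, the map $F(\underline{Hom}(X,Y))\to\underline{Hom}(F(X),F(Y))$ induced by applying $F$ to the evaluation map is an isomorphism. An internal cover of an ind-closed category $\mathcal{C}_0$ consists of an ind-closed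 category $\mathcal{C}$, closed functors $I:\mathcal{C}_0\to\mathcal{C}$ and $F:\mathcal{C}\to\mathcal{C}_0$, and an isomorphism of $F\circ I$ with the identity functor (treated as an equality). $\Gamma_{\mathcal{D}}:\mathcal{D}\to\mathrm{Set}$ is the global sections functor $X\mapsto Hom(\mathbf{1},X)$. For a functor $R$ on $\mathcal{C}$, $\mathrm{Aut}(R/I)$ is the group of natural automorphisms $t$ of $R$ such that $t_{I(X)}$ is the identity for every object $X$ of $\mathcal{C}_0$. -}

module Defs where

open import Level using (Level; _⊔_) renaming (suc to lsuc)
open import Data.Nat.Base using (ℕ)
open import Data.Fin.Base using (Fin; zero; suc)
open import Data.Unit.Polymorphic.Base using (⊤; tt)
open import Data.Product.Base using (Σ-syntax; _×_; _,_)
open import Relation.Binary.Bundles using (Setoid)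
open import Relation.Binary.Structures using (IsEquivalence)
import Relation.Binary.Reasoning.Setoid as SetoidReasoning
open import Function.Bundles using (Func; _⟨$⟩_)
import Function.Construct.Identity as Identity
import Function.Construct.Composition as Composition
import Function.Relation.Binary.Setoid.Equality as FuncEquality
open import Algebra.Bundles using (Group)

-- The level ℓ plays the role of "small": hom-sets are ℓ-small setoids, while
-- the collection of objects may be larger (see EssentiallySmall).

record Category (o ℓ : Level) : Set (lsuc (o ⊔ ℓ)) where
  infix  4 _≈_ _⇒_
  infixr 9 _∘_
  field
    Obj : Set o
    _⇒_ : Obj → Obj → Set ℓ
    _≈_ : ∀ {A B} → A ⇒ B → A ⇒ B → Set ℓ
    id  : ∀ {A} → A ⇒ A
    _∘_ : ∀ {A B C} → B ⇒ C → A ⇒ B → A ⇒ C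
    isEquivalence : ∀ {A B} → IsEquivalence (_≈_ {A} {B})
    ∘-cong    : ∀ {A B C} {f h : B ⇒ C} {g k : A ⇒ B} →
                f ≈ h → g ≈ k → f ∘ g ≈ h ∘ k
    assoc     : ∀ {A B C D} {f : A ⇒ B} {g : B ⇒ C} {h : C ⇒ D} →
                (h ∘ g) ∘ f ≈ h ∘ (g ∘ f)
    identityˡ : ∀ {A B} {f : A ⇒ B} → id ∘ f ≈ f
    identityʳ : ∀ {A B} {f : A ⇒ B} → f ∘ id ≈ f

  homSetoid : Obj → Obj → Setoid ℓ ℓ
  homSetoid A B = record { isEquivalence = isEquivalence {A} {B} }

  module ≈ {A B : Obj} = IsEquivalence (isEquivalence {A} {B})
  module ≈-Reasoning {A B : Obj} = SetoidReasoning (homSetoid A B)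

  ∘-congˡ : ∀ {A B C} {f h : B ⇒ C} {g : A ⇒ B} → f ≈ h → f ∘ g ≈ h ∘ g
  ∘-congˡ p = ∘-cong p ≈.refl

  ∘-congʳ : ∀ {A B C} {f : B ⇒ C} {g k : A ⇒ B} → g ≈ k → f ∘ g ≈ f ∘ k
  ∘-congʳ p = ∘-cong ≈.refl p

  record IsIso {A B : Obj} (f : A ⇒ B) : Set ℓ where
    field
      inv  : B ⇒ A
      isoˡ : inv ∘ f ≈ id
      isoʳ : f ∘ inv ≈ id

private
  variable
    o o₀ o₁ o₂ o₃ ℓ : Level

op : Category o ℓ → Category o ℓ
op C = record
  { Obj = Obj
  ; _⇒_ = λ A B → B ⇒ A
  ; _≈_ = _≈_
  ; id  = id
  ; _∘_ = λ f g → g ∘ f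
  ; isEquivalence = isEquivalence
  ; ∘-cong    = λ p q → ∘-cong q p
  ; assoc     = ≈.sym assoc
  ; identityˡ = identityʳ
  ; identityʳ = identityˡ
  }
  where open Category C

Setoids : (ℓ : Level) → Category (lsuc ℓ) ℓ
Setoids ℓ = record
  { Obj = Setoid ℓ ℓ
  ; _⇒_ = Func
  ; _≈_ = λ {A} {B} → FuncEquality._≈_ A B
  ; id  = λ {A} → Identity.function A
  ; _∘_ = λ g f → Composition.function f g
  ; isEquivalence = λ {A} {B} → FuncEquality.isEquivalence A B
  ; ∘-cong    = λ {A} {B} {C} {f} {h} {g} {k} p q x →
                  Setoid.trans C (Func.cong f (q x)) (p (k ⟨$⟩ x))
  ; assoc     = λ {A} {B} {C} {D} x → Setoid.refl D
  ; identityˡ = λ {A} {B} x → Setoid.refl B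
  ; identityʳ = λ {A} {B} x → Setoid.refl B
  }

record Functor (C : Category o₁ ℓ) (D : Category o₂ ℓ) : Set (o₁ ⊔ o₂ ⊔ ℓ) where
  private
    module C = Category C
    module D = Category D
  field
    F₀ : C.Obj → D.Obj
    F₁ : ∀ {A B} → A C.⇒ B → F₀ A D.⇒ F₀ B
    F-cong       : ∀ {A B} {f g : A C.⇒ B} → f C.≈ g → F₁ f D.≈ F₁ g
    identity     : ∀ {A} → F₁ (C.id {A}) D.≈ D.id
    homomorphism : ∀ {A B E} {f : A C.⇒ B} {g : B C.⇒ E} →
                   F₁ (g C.∘ f) D.≈ F₁ g D.∘ F₁ f

idF : (C : Category o ℓ) → Functor C C
idF C = record
  { F₀ = λ A → A
  ; F₁ = λ f → f
  ; F-cong = λ p → p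
  ; identity = ≈.refl
  ; homomorphism = ≈.refl
  }
  where open Category C

infixr 9 _∘F_
_∘F_ : {C : Category o₁ ℓ} {D : Category o₂ ℓ} {E : Category o₃ ℓ} →
       Functor D E → Functor C D → Functor C E
_∘F_ {E = E} G F = record
  { F₀ = λ A → G.F₀ (F.F₀ A)
  ; F₁ = λ f → G.F₁ (F.F₁ f)
  ; F-cong = λ p → G.F-cong (F.F-cong p)
  ; identity = E.≈.trans (G.F-cong F.identity) G.identity
  ; homomorphism = E.≈.trans (G.F-cong F.homomorphism) G.homomorphism
  }
  where
  module E = Category E
  module F = Functor F
  module G = Functor G

module _ {C : Category o₁ ℓ} {D : Category o₂ ℓ} where
  private
    module C = Category C
    module D = Category D
  open Functor

  record NaturalTransformation (F G : Functor C D) : Set (o₁ ⊔ ℓ) where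
    field
      η       : ∀ X → F₀ F X D.⇒ F₀ G X
      natural : ∀ {X Y} (f : X C.⇒ Y) → η Y D.∘ F₁ F f D.≈ F₁ G f D.∘ η X

  IsNaturalIso : {F G : Functor C D} → NaturalTransformation F G → Set (o₁ ⊔ ℓ)
  IsNaturalIso α = ∀ X → D.IsIso (NaturalTransformation.η α X)

  record NaturalIsomorphism (F G : Functor C D) : Set (o₁ ⊔ ℓ) where
    field
      transformation : NaturalTransformation F G
      isNaturalIso   : IsNaturalIso transformation
    open NaturalTransformation transformation public

record EssentiallySmall {o ℓ : Level} (C : Category o ℓ) : Set (o ⊔ lsuc ℓ) where
  field
    Small : Category ℓ ℓ
    from  : Functor Small C
    to    : Functor C Small
    from∘to≅id : NaturalIsomorphism (from ∘F to) (idF C)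
    to∘from≅id : NaturalIsomorphism (to ∘F from) (idF Small)

-- Shapes are finite graphs.  A limit of a functor from a finite category is
-- the same thing as a limit of the diagram on its underlying graph, and a
-- diagram on a finite graph may be replaced by one on a finite category, so
-- this yields the usual finite limits.

record FiniteGraph : Set where
  field
    vertices edges : ℕ
    source target  : Fin edges → Fin vertices

module _ (G : FiniteGraph) (C : Category o ℓ) where
  open FiniteGraph G
  open Category C

  record Diagram : Set (o ⊔ ℓ) where
    field
      ob  : Fin vertices → Obj
      arr : ∀ e → ob (source e) ⇒ ob (target e)

module _ {G : FiniteGraph} {C : Category o ℓ} where
  open FiniteGraph G
  open Category C

  record Cone (Δ : Diagram G C) : Set (o ⊔ ℓ) where
    open Diagram Δ
    field
      apex    : Obj
      leg     : ∀ v → apex ⇒ ob v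
      commute : ∀ e → arr e ∘ leg (source e) ≈ leg (target e)

  open Cone

  record IsLimit {Δ : Diagram G C} (K : Cone Δ) : Set (o ⊔ ℓ) where
    field
      universal : (L : Cone Δ) → apex L ⇒ apex K
      factors   : (L : Cone Δ) → ∀ v → leg K v ∘ universal L ≈ leg L v
      unique    : (L : Cone Δ) (h : apex L ⇒ apex K) →
                  (∀ v → leg K v ∘ h ≈ leg L v) → h ≈ universal L

  record Limit (Δ : Diagram G C) : Set (o ⊔ ℓ) where
    field
      cone    : Cone Δ
      isLimit : IsLimit cone
    open Cone cone public
    open IsLimit isLimit public

FiniteLimits : Category o ℓ → Set (o ⊔ ℓ)
FiniteLimits C = ∀ {G} (Δ : Diagram G C) → Limit Δ

module _ {G : FiniteGraph} {C : Category o₁ ℓ} {D : Category o₂ ℓ}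
         (F : Functor C D) where
  open Functor F
  private
    module D = Category D

  mapDiagram : Diagram G C → Diagram G D
  mapDiagram Δ = record { ob = λ v → F₀ (ob v) ; arr = λ e → F₁ (arr e) }
    where open Diagram Δ

  mapCone : {Δ : Diagram G C} → Cone Δ → Cone (mapDiagram Δ)
  mapCone K = record
    { apex    = F₀ apex
    ; leg     = λ v → F₁ (leg v)
    ; commute = λ e → D.≈.trans (D.≈.sym homomorphism) (F-cong (commute e))
    }
    where open Cone K

PreservesFiniteLimits : {C : Category o₁ ℓ} {D : Category o₂ ℓ} →
                        Functor C D → Set (o₁ ⊔ o₂ ⊔ ℓ)
PreservesFiniteLimits {C = C} F =
  ∀ {G} {Δ : Diagram G C} {K : Cone Δ} → IsLimit K → IsLimit (mapCone F K)

emptyGraph : FiniteGraph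
emptyGraph = record
  { vertices = 0 ; edges = 0 ; source = λ () ; target = λ () }

twoPoints : FiniteGraph
twoPoints = record
  { vertices = 2 ; edges = 0 ; source = λ () ; target = λ () }

-- Pairing into any limit of a diagram on two points; it serves both for the
-- chosen products of a category and for their images under functors.
module Pairing {C : Category o ℓ} {Δ : Diagram twoPoints C} {K : Cone Δ}
               (lim : IsLimit K) where
  open Category C
  open Diagram Δ
  open Cone K
  open IsLimit lim

  p₁ : apex ⇒ ob zero
  p₁ = leg zero

  p₂ : apex ⇒ ob (suc zero)
  p₂ = leg (suc zero)

  private
    fork : ∀ {A} → A ⇒ ob zero → A ⇒ ob (suc zero) → Cone Δ
    fork {A} f g = record
      { apex    = A
      ; leg     = λ { zero → f ; (suc zero) → g }
      ; commute = λ ()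
      }

  pair : ∀ {A} → A ⇒ ob zero → A ⇒ ob (suc zero) → A ⇒ apex
  pair f g = universal (fork f g)

  p₁∘pair : ∀ {A} {f : A ⇒ ob zero} {g : A ⇒ ob (suc zero)} →
            p₁ ∘ pair f g ≈ f
  p₁∘pair {f = f} {g} = factors (fork f g) zero

  p₂∘pair : ∀ {A} {f : A ⇒ ob zero} {g : A ⇒ ob (suc zero)} →
            p₂ ∘ pair f g ≈ g
  p₂∘pair {f = f} {g} = factors (fork f g) (suc zero)

  pair-unique : ∀ {A} {f : A ⇒ ob zero} {g : A ⇒ ob (suc zero)}
                {h : A ⇒ apex} → p₁ ∘ h ≈ f → p₂ ∘ h ≈ g → h ≈ pair f g
  pair-unique {f = f} {g} {h} r s =
    unique (fork f g) h λ { zero → r ; (suc zero) → s }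

  pair-cong : ∀ {A} {f f′ : A ⇒ ob zero} {g g′ : A ⇒ ob (suc zero)} →
              f ≈ f′ → g ≈ g′ → pair f g ≈ pair f′ g′
  pair-cong r s = pair-unique (≈.trans p₁∘pair r) (≈.trans p₂∘pair s)

  pair∘ : ∀ {A B} {f : A ⇒ ob zero} {g : A ⇒ ob (suc zero)} {h : B ⇒ A} →
          pair f g ∘ h ≈ pair (f ∘ h) (g ∘ h)
  pair∘ = pair-unique
    (≈.trans (≈.sym assoc) (∘-congˡ p₁∘pair))
    (≈.trans (≈.sym assoc) (∘-congˡ p₂∘pair))

module FiniteLimitOps {C : Category o ℓ} (lim : FiniteLimits C) where
  open Category C

  terminal : Limit {G = emptyGraph} {C = C} (record { ob = λ () ; arr = λ () })
  terminal = lim _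

  𝟏 : Obj
  𝟏 = Limit.apex terminal

  product : (A B : Obj) →
            Limit {G = twoPoints} {C = C}
              (record { ob = λ { zero → A ; (suc zero) → B } ; arr = λ () })
  product A B = lim _

  infixr 7 _⊗_
  _⊗_ : Obj → Obj → Obj
  A ⊗ B = Limit.apex (product A B)

  module _ {A B : Obj} where
    open Pairing (Limit.isLimit (product A B)) public
      renaming (p₁ to π₁; p₂ to π₂; pair to ⟨_,_⟩; p₁∘pair to π₁∘⟨⟩;
                p₂∘pair to π₂∘⟨⟩; pair-unique to ⟨⟩-unique;
                pair-cong to ⟨⟩-cong; pair∘ to ⟨⟩∘)

  infixl 10 _⊗id
  _⊗id : ∀ {A B X} → A ⇒ B → A ⊗ X ⇒ B ⊗ X
  f ⊗id = ⟨ f ∘ π₁ , π₂ ⟩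

  ⊗id-cong : ∀ {A B X} {f g : A ⇒ B} → f ≈ g → _⊗id {X = X} f ≈ g ⊗id
  ⊗id-cong p = ⟨⟩-cong (∘-congˡ p) ≈.refl

  ⊗id-id : ∀ {A X} → _⊗id {X = X} (id {A}) ≈ id
  ⊗id-id = ≈.sym (⟨⟩-unique (≈.trans identityʳ (≈.sym identityˡ)) identityʳ)

  ⊗id-∘ : ∀ {A B E X} {f : A ⇒ B} {g : B ⇒ E} →
          _⊗id {X = X} (g ∘ f) ≈ g ⊗id ∘ f ⊗id
  ⊗id-∘ {f = f} {g} = ≈.sym (≈.trans ⟨⟩∘ (⟨⟩-cong
    (≈.trans assoc (≈.trans (∘-congʳ π₁∘⟨⟩) (≈.sym assoc)))
    π₂∘⟨⟩))

  -⊗_ : Obj → Functor C C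
  -⊗ X = record
    { F₀ = _⊗ X
    ; F₁ = _⊗id
    ; F-cong = ⊗id-cong
    ; identity = ⊗id-id
    ; homomorphism = ⊗id-∘
    }

record IsFiltered (J : Category o ℓ) : Set (o ⊔ ℓ) where
  open Category J
  field
    point : Obj
    upper : ∀ i j → Σ[ k ∈ Obj ] (i ⇒ k) × (j ⇒ k)
    coeq  : ∀ {i j} (u v : i ⇒ j) → Σ[ k ∈ Obj ] Σ[ w ∈ j ⇒ k ] w ∘ u ≈ w ∘ v

record IndObject {o ℓ : Level} (C : Category o ℓ) : Set (o ⊔ lsuc ℓ) where
  field
    Index    : Category ℓ ℓ
    filtered : IsFiltered Index
    diagram  : Functor Index C
  module Index = Category Index
  open Functor diagram public
    renaming (F₀ to at; F₁ to tr; F-cong to tr-cong;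
              identity to tr-id; homomorphism to tr-∘)
  open IsFiltered filtered public

module _ {C : Category o ℓ} where
  open Category C
  open IndObject

  -- The filtered colimit, over the indices i of P, of the sets Hom(Z, P i).
  record Elem (P : IndObject C) (Z : Obj) : Set ℓ where
    constructor _,_
    field
      stage : Index.Obj P
      map   : Z ⇒ at P stage
  open Elem

  infix 4 _∼_
  record _∼_ {P : IndObject C} {Z : Obj} (a b : Elem P Z) : Set ℓ where
    field
      later : Index.Obj P
      left  : Index._⇒_ P (stage a) later
      right : Index._⇒_ P (stage b) later
      agree : tr P left ∘ map a ≈ tr P right ∘ map b
  open _∼_

  module _ {P : IndObject C} {Z : Obj} where
    private
      module J = Category (Index P)

    sameStage : ∀ {i} {f g : Z ⇒ at P i} → f ≈ g → _∼_ {P} (i , f) (i , g)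
    sameStage {i} p = record
      { later = i ; left = J.id ; right = J.id ; agree = ∘-congʳ p }

    transport : ∀ {i j} {f : Z ⇒ at P i} (u : i J.⇒ j) →
                _∼_ {P} (i , f) (j , tr P u ∘ f)
    transport {j = j} u = record
      { later = j ; left = u ; right = J.id
      ; agree = ≈.sym (≈.trans (∘-congˡ (tr-id P)) identityˡ) }

    ∼-refl : {a : Elem P Z} → a ∼ a
    ∼-refl = sameStage ≈.refl

    ∼-sym : {a b : Elem P Z} → a ∼ b → b ∼ a
    ∼-sym p = record
      { later = later p ; left = right p ; right = left p
      ; agree = ≈.sym (agree p) }

    ∼-trans : {a b c : Elem P Z} → a ∼ b → b ∼ c → a ∼ c
    ∼-trans {a} {b} {c} p q with upper P (later p) (later q)
    ... | k , u , v with coeq P (u J.∘ right p) (v J.∘ left q)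
    ... | m , w , w-eq = record
      { later = m
      ; left  = (w J.∘ u) J.∘ left p
      ; right = (w J.∘ v) J.∘ right q
      ; agree = begin
          tr P ((w J.∘ u) J.∘ left p) ∘ map a        ≈⟨ push ⟩
          tr P (w J.∘ u) ∘ (tr P (left p) ∘ map a)   ≈⟨ ∘-congʳ (agree p) ⟩
          tr P (w J.∘ u) ∘ (tr P (right p) ∘ map b)  ≈⟨ push ⟨
          tr P ((w J.∘ u) J.∘ right p) ∘ map b       ≈⟨ ∘-congˡ (tr-cong P mid) ⟩
          tr P ((w J.∘ v) J.∘ left q) ∘ map b        ≈⟨ push ⟩
          tr P (w J.∘ v) ∘ (tr P (left q) ∘ map b)   ≈⟨ ∘-congʳ (agree q) ⟩
          tr P (w J.∘ v) ∘ (tr P (right q) ∘ map c)  ≈⟨ push ⟨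
          tr P ((w J.∘ v) J.∘ right q) ∘ map c       ∎
      }
      where
      open ≈-Reasoning
      push : ∀ {i j l} {x : j J.⇒ l} {y : i J.⇒ j} {f : Z ⇒ at P i} →
             tr P (x J.∘ y) ∘ f ≈ tr P x ∘ (tr P y ∘ f)
      push = ≈.trans (∘-congˡ (tr-∘ P)) assoc
      mid : (w J.∘ u) J.∘ right p J.≈ (w J.∘ v) J.∘ left q
      mid = J.≈.trans J.assoc (J.≈.trans w-eq (J.≈.sym J.assoc))

    ∼-isEquivalence : IsEquivalence (_∼_ {P} {Z})
    ∼-isEquivalence = record
      { refl = ∼-refl ; sym = ∼-sym ; trans = ∼-trans }

  elemSetoid : IndObject C → Obj → Setoid ℓ ℓ
  elemSetoid P Z = record { isEquivalence = ∼-isEquivalence {P} {Z} }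

  restrict : {P : IndObject C} {Z W : Obj} → W ⇒ Z → Elem P Z → Elem P W
  restrict h a = stage a , map a ∘ h

  restrict-cong : {P : IndObject C} {Z W : Obj} {h k : W ⇒ Z} {a b : Elem P Z} →
                  h ≈ k → a ∼ b → restrict h a ∼ restrict k b
  restrict-cong p q = record
    { later = later q ; left = left q ; right = right q
    ; agree = ≈.trans (≈.sym assoc) (≈.trans (∘-cong (agree q) p) assoc) }

  restrict-∘ : {P : IndObject C} {Z W V : Obj} {h : W ⇒ Z} {k : V ⇒ W}
               {a : Elem P Z} → restrict k (restrict h a) ∼ restrict (h ∘ k) a
  restrict-∘ = sameStage assoc

  -- Elem P Z amounts to the ind-morphisms from the constant object Z to P, so
  -- this is the presheaf represented by P.
  presheaf : IndObject C → Functor (op C) (Setoids ℓ)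
  presheaf P = record
    { F₀ = elemSetoid P
    ; F₁ = λ h → record { to = restrict h ; cong = restrict-cong ≈.refl }
    ; F-cong = λ p a → sameStage (∘-congʳ p)
    ; identity = λ a → sameStage identityʳ
    ; homomorphism = λ a → sameStage (≈.sym assoc)
    }

  -- Hom(P, Q) = lim over i of colim over j of Hom(P i, Q j).
  record IndHom (P Q : IndObject C) : Set ℓ where
    field
      component  : ∀ i → Elem Q (at P i)
      compatible : ∀ {i j} (u : Index._⇒_ P i j) →
                   restrict (tr P u) (component j) ∼ component i
  open IndHom

  infix 4 _≈ᵢ_
  _≈ᵢ_ : {P Q : IndObject C} → IndHom P Q → IndHom P Q → Set ℓ
  φ ≈ᵢ ψ = ∀ i → component φ i ∼ component ψ i

  infixr 9 _⋆_ _∘ᵢ_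
  _⋆_ : {P Q : IndObject C} {Z : Obj} → IndHom P Q → Elem P Z → Elem Q Z
  φ ⋆ a = restrict (map a) (component φ (stage a))

  ⋆-cong : {P Q : IndObject C} {Z : Obj} {φ ψ : IndHom P Q} {a b : Elem P Z} →
           φ ≈ᵢ ψ → a ∼ b → φ ⋆ a ∼ ψ ⋆ b
  ⋆-cong {P} {φ = φ} {ψ} {a} {b} p q =
    ∼-trans (forward φ (left q))
      (∼-trans (restrict-cong (agree q) (p (later q)))
        (∼-sym (forward ψ (right q))))
    where
    forward : ∀ χ {c} {k} (u : Index._⇒_ P (stage c) k) →
              χ ⋆ c ∼ restrict (tr P u ∘ map c) (component χ k)
    forward χ u = ∼-trans
      (restrict-cong ≈.refl (∼-sym (compatible χ u))) restrict-∘

  ⋆-congʳ : {P Q : IndObject C} {Z : Obj} (φ : IndHom P Q) {a b : Elem P Z} →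
            a ∼ b → φ ⋆ a ∼ φ ⋆ b
  ⋆-congʳ φ = ⋆-cong {φ = φ} {φ} (λ _ → ∼-refl)

  ⋆-restrict : {P Q : IndObject C} {Z W : Obj} (φ : IndHom P Q) {h : W ⇒ Z}
               {a : Elem P Z} → restrict h (φ ⋆ a) ∼ φ ⋆ restrict h a
  ⋆-restrict φ = restrict-∘

  idᵢ : {P : IndObject C} → IndHom P P
  idᵢ {P} = record
    { component  = λ i → i , id
    ; compatible = λ u → ∼-sym (∼-trans (transport u)
        (sameStage (≈.trans identityʳ (≈.sym identityˡ))))
    }

  _∘ᵢ_ : {P Q R : IndObject C} → IndHom Q R → IndHom P Q → IndHom P R
  ψ ∘ᵢ φ = record
    { component  = λ i → ψ ⋆ component φ i
    ; compatible = λ u → ∼-trans (⋆-restrict ψ)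
        (⋆-congʳ ψ (compatible φ u))
    }

Ind : {o ℓ : Level} → Category o ℓ → Category (o ⊔ lsuc ℓ) ℓ
Ind C = record
  { Obj = IndObject C
  ; _⇒_ = IndHom
  ; _≈_ = _≈ᵢ_
  ; id  = idᵢ
  ; _∘_ = _∘ᵢ_
  ; isEquivalence = record
      { refl  = λ i → ∼-refl
      ; sym   = λ p i → ∼-sym (p i)
      ; trans = λ p q i → ∼-trans (p i) (q i)
      }
  ; ∘-cong    = λ {_} {_} {_} {ψ} {ψ′} p q i → ⋆-cong {φ = ψ} {ψ′} p (q i)
  ; assoc     = λ {_} {_} {_} {_} {f} {g} {h} i →
                  ⋆-restrict h {a = IndHom.component g _}
  ; identityˡ = λ i → sameStage identityˡ
  ; identityʳ = λ i → sameStage identityʳ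
  }
  where open Category C

terminalCategory : {ℓ : Level} → Category ℓ ℓ
terminalCategory = record
  { Obj = ⊤
  ; _⇒_ = λ _ _ → ⊤
  ; _≈_ = λ _ _ → ⊤
  ; id  = tt
  ; _∘_ = λ _ _ → tt
  ; isEquivalence = record
      { refl = tt ; sym = λ _ → tt ; trans = λ _ _ → tt }
  ; ∘-cong    = λ _ _ → tt
  ; assoc     = tt
  ; identityˡ = tt
  ; identityʳ = tt
  }

constant : {C : Category o ℓ} → Category.Obj C → IndObject C
constant {C = C} X = record
  { Index    = terminalCategory
  ; filtered = record
      { point = tt
      ; upper = λ _ _ → tt , tt , tt
      ; coeq  = λ _ _ → tt , tt , tt
      }
  ; diagram  = record
      { F₀ = λ _ → X
      ; F₁ = λ _ → id
      ; F-cong = λ _ → ≈.refl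
      ; identity = ≈.refl
      ; homomorphism = ≈.sym identityˡ
      }
  }
  where open Category C

module _ {C : Category o₁ ℓ} {D : Category o₂ ℓ} (F : Functor C D) where
  private
    module C = Category C
    module D = Category D
    module F = Functor F
  open IndObject
  open Elem
  open IndHom

  mapInd : IndObject C → IndObject D
  mapInd P = record
    { Index = Index P ; filtered = filtered P ; diagram = F ∘F diagram P }

  mapElem : {P : IndObject C} {Z : C.Obj} → Elem P Z → Elem (mapInd P) (F.F₀ Z)
  mapElem a = stage a , F.F₁ (map a)

  mapElem-cong : {P : IndObject C} {Z : C.Obj} {a b : Elem P Z} →
                 a ∼ b → mapElem a ∼ mapElem b
  mapElem-cong p = record
    { later = later ; left = left ; right = right
    ; agree = D.≈.trans (D.≈.sym F.homomorphism)
        (D.≈.trans (F.F-cong agree) F.homomorphism) }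
    where open _∼_ p

  mapElem-restrict : {P : IndObject C} {Z W : C.Obj} {h : W C.⇒ Z}
                     {a : Elem P Z} →
                     mapElem (restrict h a) ∼ restrict (F.F₁ h) (mapElem a)
  mapElem-restrict = sameStage F.homomorphism

  mapIndHom : {P Q : IndObject C} → IndHom P Q → IndHom (mapInd P) (mapInd Q)
  mapIndHom φ = record
    { component  = λ i → mapElem (component φ i)
    ; compatible = λ u → ∼-trans (∼-sym mapElem-restrict)
        (mapElem-cong (compatible φ u))
    }

  extendToInd : Functor (Ind C) (Ind D)
  extendToInd = record
    { F₀ = mapInd
    ; F₁ = mapIndHom
    ; F-cong = λ p i → mapElem-cong (p i)
    ; identity = λ i → sameStage F.identity
    ; homomorphism = λ i → mapElem-restrict
    }

internalHom : {C : Category o ℓ} → FiniteLimits C →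
              (X Y : Category.Obj C) → Functor (op C) (Setoids ℓ)
internalHom {C = C} lim X Y = record
  { F₀ = λ Z → homSetoid (Z ⊗ X) Y
  ; F₁ = λ h → record { to = _∘ (h ⊗id) ; cong = ∘-congˡ }
  ; F-cong = λ p f → ∘-congʳ (⊗id-cong p)
  ; identity = λ f → ≈.trans (∘-congʳ ⊗id-id) identityʳ
  ; homomorphism = λ f → ≈.trans (∘-congʳ ⊗id-∘) (≈.sym assoc)
  }
  where
  open Category C
  open FiniteLimitOps lim

record IndClosed {o ℓ : Level} (C : Category o ℓ) : Set (o ⊔ lsuc ℓ) where
  open Category C
  field
    finiteLimits : FiniteLimits C
    hom          : Obj → Obj → IndObject C
    represents   : ∀ X Y → NaturalIsomorphism (presheaf (hom X Y))
                                              (internalHom finiteLimits X Y)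

  open FiniteLimitOps finiteLimits public

  transpose : ∀ {X Y Z} → Elem (hom X Y) Z → Z ⊗ X ⇒ Y
  transpose {X} {Y} {Z} a = NaturalIsomorphism.η (represents X Y) Z ⟨$⟩ a

  -- The product of an ind-object with X is formed termwise.  At the index i,
  -- evaluation is the transpose of the coprojection of hom X Y at i.
  evaluation : ∀ X Y → IndHom (mapInd (-⊗ X) (hom X Y)) (constant Y)
  evaluation X Y = record
    { component  = λ i → tt , transpose (i , id)
    ; compatible = λ {i} {j} u → sameStage (begin
        transpose (j , id) ∘ tr u ⊗id  ≈⟨ natural (tr u) (j , id) ⟨
        transpose (j , id ∘ tr u)      ≈⟨ Func.cong (η _) (idᵢ.compatible u) ⟩
        transpose (i , id)             ∎)
    }
    where
    open ≈-Reasoning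
    open IndObject (hom X Y)
    open NaturalIsomorphism (represents X Y) using (η; natural)
    module idᵢ = IndHom (idᵢ {P = hom X Y})

module _ {C : Category o₁ ℓ} {D : Category o₂ ℓ} (F : Functor C D)
         (C-closed : IndClosed C) (D-lim : FiniteLimits D)
         (F-lex : PreservesFiniteLimits F) where
  private
    module C = IndClosed C-closed
    open Category D
    open FiniteLimitOps D-lim
    open Functor F
    open IndObject using (tr)
    open Elem

  module _ (X Y : Category.Obj C) where
    private
      module FPair {A : Category.Obj C} =
        Pairing (F-lex (Limit.isLimit (C.product A X)))
      P   = C.hom X Y
      P⊗X = mapInd (C.-⊗ X) P

    -- W → F(P) goes to W × F(X) → F(P) × F(X) ≅ F(P × X).
    timesFX : ∀ {W} → Elem (mapInd F P) W → Elem (mapInd F P⊗X) (W ⊗ F₀ X)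
    timesFX (i , w) = i , FPair.pair (w ∘ π₁) π₂

    private
      F⊗id∘pair : ∀ {A B Z} {u : Category._⇒_ C A B} {f : Z ⇒ F₀ A} {g : Z ⇒ F₀ X} →
                  F₁ (u C.⊗id) ∘ FPair.pair f g ≈ FPair.pair (F₁ u ∘ f) g
      F⊗id∘pair {u = u} {f} {g} = FPair.pair-unique
        (begin
          F₁ C.π₁ ∘ (F₁ (u C.⊗id) ∘ FPair.pair f g)  ≈⟨ assoc ⟨
          (F₁ C.π₁ ∘ F₁ (u C.⊗id)) ∘ FPair.pair f g  ≈⟨ ∘-congˡ homomorphism ⟨
          F₁ (C.π₁ ∘C u C.⊗id) ∘ FPair.pair f g      ≈⟨ ∘-congˡ (F-cong C.π₁∘⟨⟩) ⟩
          F₁ (u ∘C C.π₁) ∘ FPair.pair f g            ≈⟨ ∘-congˡ homomorphism ⟩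
          (F₁ u ∘ F₁ C.π₁) ∘ FPair.pair f g          ≈⟨ assoc ⟩
          F₁ u ∘ (F₁ C.π₁ ∘ FPair.pair f g)          ≈⟨ ∘-congʳ FPair.p₁∘pair ⟩
          F₁ u ∘ f                                   ∎)
        (begin
          F₁ C.π₂ ∘ (F₁ (u C.⊗id) ∘ FPair.pair f g)  ≈⟨ assoc ⟨
          (F₁ C.π₂ ∘ F₁ (u C.⊗id)) ∘ FPair.pair f g  ≈⟨ ∘-congˡ homomorphism ⟨
          F₁ (C.π₂ ∘C u C.⊗id) ∘ FPair.pair f g      ≈⟨ ∘-congˡ (F-cong C.π₂∘⟨⟩) ⟩
          F₁ C.π₂ ∘ FPair.pair f g                   ≈⟨ FPair.p₂∘pair ⟩
          g                                          ∎)
        where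
        open ≈-Reasoning
        infixr 9 _∘C_
        _∘C_ = Category._∘_ C

      timesFX-cong : ∀ {W} {a b : Elem (mapInd F P) W} →
                     a ∼ b → timesFX a ∼ timesFX b
      timesFX-cong p = record
        { later = later ; left = left ; right = right
        ; agree = ≈.trans F⊗id∘pair (≈.trans (FPair.pair-cong
            (≈.trans (≈.sym assoc) (≈.trans (∘-congˡ agree) assoc)) ≈.refl)
            (≈.sym F⊗id∘pair)) }
        where open _∼_ p

      timesFX-natural : ∀ {W V} (h : V ⇒ W) (a : Elem (mapInd F P) W) →
                        timesFX (restrict h a) ∼ restrict (h ⊗id) (timesFX a)
      timesFX-natural h a = sameStage (≈.sym (≈.trans FPair.pair∘
        (FPair.pair-cong
          (≈.trans assoc (≈.trans (∘-congʳ π₁∘⟨⟩) (≈.sym assoc)))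
          π₂∘⟨⟩)))

      -- The identification of F(Y), as a constant ind-object, with F(Y).
      map-cong : ∀ {Z} {a b : Elem (mapInd F (constant Y)) Z} →
                 a ∼ b → map a ≈ map b
      map-cong p = ≈.trans (≈.sym Fid∘) (≈.trans agree Fid∘)
        where
        open _∼_ p
        Fid∘ : ∀ {Z} {f : Z ⇒ F₀ Y} → F₁ (Category.id C) ∘ f ≈ f
        Fid∘ = ≈.trans (∘-congˡ identity) identityˡ

    -- F(Hom(X,Y)) → Hom(F(X),F(Y)), as a map of presheaves on D: w goes to
    -- the composite W × F(X) → F(Hom(X,Y) × X) → F(Y), where the second map
    -- is the image of evaluation.
    comparison : NaturalTransformation (presheaf (mapInd F P))
                                       (internalHom D-lim (F₀ X) (F₀ Y))
    comparison = record
      { η = λ W → record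
          { to   = λ a → map (Fev ⋆ timesFX a)
          ; cong = λ p → map-cong (⋆-congʳ Fev (timesFX-cong p))
          }
      ; natural = λ h a → map-cong (∼-trans
          (⋆-congʳ Fev (timesFX-natural h a))
          (∼-sym (⋆-restrict Fev {a = timesFX a})))
      }
      where
      Fev : IndHom (mapInd F P⊗X) (mapInd F (constant Y))
      Fev = mapIndHom F (C.evaluation X Y)

record IsClosed {C : Category o₁ ℓ} {D : Category o₂ ℓ}
                (C-closed : IndClosed C) (D-lim : FiniteLimits D)
                (F : Functor C D) : Set (o₁ ⊔ o₂ ⊔ ℓ) where
  field
    preservesFiniteLimits : PreservesFiniteLimits F
    comparison-iso : ∀ X Y →
      IsNaturalIso (comparison F C-closed D-lim preservesFiniteLimits X Y)

record InternalCover {C₀ : Category o₀ ℓ} {C : Category o₁ ℓ}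
                     (C₀-closed : IndClosed C₀) (C-closed : IndClosed C) :
                     Set (o₀ ⊔ o₁ ⊔ ℓ) where
  field
    I : Functor C₀ C
    F : Functor C C₀
    I-closed : IsClosed C₀-closed (IndClosed.finiteLimits C-closed) I
    F-closed : IsClosed C-closed (IndClosed.finiteLimits C₀-closed) F
    F∘I≅id   : NaturalIsomorphism (F ∘F I) (idF C₀)

Γ : {D : Category o ℓ} → FiniteLimits D → Functor D (Setoids ℓ)
Γ {D = D} lim = record
  { F₀ = homSetoid 𝟏
  ; F₁ = λ f → record { to = f ∘_ ; cong = ∘-congʳ }
  ; F-cong = λ p x → ∘-congˡ p
  ; identity = λ x → identityˡ
  ; homomorphism = λ x → assoc
  }
  where
  open Category D
  open FiniteLimitOps lim

module _ {C₀ : Category o₀ ℓ} {C : Category o₁ ℓ} {E : Category o₂ ℓ}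
         (R : Functor C E) (I : Functor C₀ C) where
  private
    module C₀ = Category C₀
    module C = Category C
    module R = Functor R
    module I = Functor I
  open Category E

  record AutOver : Set (o₀ ⊔ o₁ ⊔ ℓ) where
    field
      automorphism : NaturalIsomorphism R R
      fixes        : ∀ X → NaturalIsomorphism.η automorphism (I.F₀ X) ≈ id
    open NaturalIsomorphism automorphism public
    module Iso X = IsIso (isNaturalIso X)

  open AutOver

  private
    cancelInner : ∀ {A B Z W} {f : B ⇒ A} {g : A ⇒ B} {h : A ⇒ Z} {k : W ⇒ A} →
                  f ∘ g ≈ id → (h ∘ f) ∘ (g ∘ k) ≈ h ∘ k
    cancelInner p = ≈.trans assoc (∘-congʳ
      (≈.trans (≈.sym assoc) (≈.trans (∘-congˡ p) identityˡ)))

    idAut : AutOver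
    idAut = record
      { automorphism = record
          { transformation = record
              { η = λ _ → id
              ; natural = λ f → ≈.trans identityˡ (≈.sym identityʳ)
              }
          ; isNaturalIso = λ _ → record
              { inv = id ; isoˡ = identityˡ ; isoʳ = identityˡ }
          }
      ; fixes = λ _ → ≈.refl
      }

    compAut : AutOver → AutOver → AutOver
    compAut s t = record
      { automorphism = record
          { transformation = record
              { η = λ X → η s X ∘ η t X
              ; natural = λ f → ≈.trans assoc (≈.trans (∘-congʳ (natural t f))
                  (≈.trans (≈.sym assoc) (≈.trans (∘-congˡ (natural s f)) assoc)))
              }
          ; isNaturalIso = λ X → record
              { inv  = Iso.inv t X ∘ Iso.inv s X
              ; isoˡ = ≈.trans (cancelInner (Iso.isoˡ s X)) (Iso.isoˡ t X)
              ; isoʳ = ≈.trans (cancelInner (Iso.isoʳ t X)) (Iso.isoʳ s X)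
              }
          }
      ; fixes = λ X → ≈.trans (∘-cong (fixes s X) (fixes t X)) identityˡ
      }

    invAut : AutOver → AutOver
    invAut t = record
      { automorphism = record
          { transformation = record
              { η = Iso.inv t
              ; natural = λ {X} {Y} f → begin
                  Iso.inv t Y ∘ R.F₁ f                          ≈⟨ identityʳ ⟨
                  (Iso.inv t Y ∘ R.F₁ f) ∘ id                   ≈⟨ ∘-congʳ (Iso.isoʳ t X) ⟨
                  (Iso.inv t Y ∘ R.F₁ f) ∘ (η t X ∘ Iso.inv t X) ≈⟨ assoc ⟩
                  Iso.inv t Y ∘ (R.F₁ f ∘ (η t X ∘ Iso.inv t X)) ≈⟨ ∘-congʳ assoc ⟨
                  Iso.inv t Y ∘ ((R.F₁ f ∘ η t X) ∘ Iso.inv t X) ≈⟨ ∘-congʳ (∘-congˡ (natural t f)) ⟨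
                  Iso.inv t Y ∘ ((η t Y ∘ R.F₁ f) ∘ Iso.inv t X) ≈⟨ ∘-congʳ assoc ⟩
                  Iso.inv t Y ∘ (η t Y ∘ (R.F₁ f ∘ Iso.inv t X)) ≈⟨ assoc ⟨
                  (Iso.inv t Y ∘ η t Y) ∘ (R.F₁ f ∘ Iso.inv t X) ≈⟨ ∘-congˡ (Iso.isoˡ t Y) ⟩
                  id ∘ (R.F₁ f ∘ Iso.inv t X)                    ≈⟨ identityˡ ⟩
                  R.F₁ f ∘ Iso.inv t X                           ∎
              }
          ; isNaturalIso = λ X → record
              { inv = η t X ; isoˡ = Iso.isoʳ t X ; isoʳ = Iso.isoˡ t X }
          }
      ; fixes = λ X → ≈.trans (≈.sym identityʳ)
          (≈.trans (∘-congʳ (≈.sym (fixes t X))) (Iso.isoˡ t (I.F₀ X)))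
      }
      where open ≈-Reasoning

  Aut : Group (o₀ ⊔ o₁ ⊔ ℓ) (o₁ ⊔ ℓ)
  Aut = record
    { Carrier = AutOver
    ; _≈_ = λ s t → ∀ X → η s X ≈ η t X
    ; _∙_ = compAut
    ; ε   = idAut
    ; _⁻¹ = invAut
    ; isGroup = record
        { isMonoid = record
            { isSemigroup = record
                { isMagma = record
                    { isEquivalence = record
                        { refl  = λ X → ≈.refl
                        ; sym   = λ p X → ≈.sym (p X)
                        ; trans = λ p q X → ≈.trans (p X) (q X)
                        }
                    ; ∙-cong = λ p q X → ∘-cong (p X) (q X)
                    }
                ; assoc = λ s t u X → assoc
                }
            ; identity = (λ t X → identityˡ) , (λ t X → identityʳ)
            }
        ; inverse = (λ t X → Iso.isoˡ t X) , (λ t X → Iso.isoʳ t X)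
        ; ⁻¹-cong = λ {s} {t} p X → begin
            Iso.inv s X                          ≈⟨ identityʳ ⟨
            Iso.inv s X ∘ id                     ≈⟨ ∘-congʳ (Iso.isoʳ t X) ⟨
            Iso.inv s X ∘ (η t X ∘ Iso.inv t X)  ≈⟨ ∘-congʳ (∘-congˡ (p X)) ⟨
            Iso.inv s X ∘ (η s X ∘ Iso.inv t X)  ≈⟨ assoc ⟨
            (Iso.inv s X ∘ η s X) ∘ Iso.inv t X  ≈⟨ ∘-congˡ (Iso.isoˡ s X) ⟩
            id ∘ Iso.inv t X                     ≈⟨ identityˡ ⟩
            Iso.inv t X                          ∎
        }
    }
    where open ≈-Reasoning

module _ {C₀ : Category o₀ ℓ} {C : Category o₁ ℓ}
         {D : Category o₂ ℓ} {E : Category o₃ ℓ}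
         (G : Functor D E) {R : Functor C D} {I : Functor C₀ C} where
  private
    module E = Category E
    module G = Functor G
  open AutOver

  applyFunctor : AutOver R I → AutOver (G ∘F R) I
  applyFunctor t = record
    { automorphism = record
        { transformation = record
            { η = λ X → G.F₁ (η t X)
            ; natural = λ f → E.≈.trans (E.≈.sym G.homomorphism)
                (E.≈.trans (G.F-cong (natural t f)) G.homomorphism)
            }
        ; isNaturalIso = λ X → record
            { inv  = G.F₁ (Iso.inv t X)
            ; isoˡ = E.≈.trans (E.≈.sym G.homomorphism)
                (E.≈.trans (G.F-cong (Iso.isoˡ t X)) G.identity)
            ; isoʳ = E.≈.trans (E.≈.sym G.homomorphism)
                (E.≈.trans (G.F-cong (Iso.isoʳ t X)) G.identity)
            }
        }
    ; fixes = λ X → E.≈.trans (G.F-cong (fixes t X)) G.identity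
    }

-- Since F is closed, every arrow g : F X → F Y of C₀ is named by a global point
-- p of F Z together with an action m : Z ⊗ X → Y in C (Z a stage of Hom(X, Y)),
-- in the sense that g = F m ∘ ⟨ p , id ⟩; and two names of the same g agree at a
-- later stage.  A natural endomorphism t of Γ ∘ H ∘ F moves p to a global point
-- of H F Z, so it turns g into a well-defined arrow H F X → H F Y, the twist of
-- g.  As t is the identity on the image of I, it is the effect on global
-- sections of H F X ≅ H F I F X → H F X, where the second map is the twist of
-- F I F X ≅ F X.

module Submission where

open import Defs
open import Level using (Level)
open import Data.Product.Base using (_,_)
open import Function.Bundles using (Func; _⟨$⟩_)
open import Algebra.Bundles using (Group)
open import Algebra.Morphism.Structures using (module GroupMorphisms)

private
  variable
    o o₀ o₁ o₂ o₃ ℓ : Level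

-- Left-exact composites, terminal objects and inverse transformations

∘F-preservesFiniteLimits : {C : Category o₁ ℓ} {D : Category o₂ ℓ} {E : Category o₃ ℓ}
  (G : Functor D E) (F : Functor C D) → PreservesFiniteLimits G →
  PreservesFiniteLimits F → PreservesFiniteLimits (G ∘F F)
∘F-preservesFiniteLimits G F G-lex F-lex {Δ = Δ} lim = record
  { universal = λ L → universal (same L)
  ; factors   = λ L → factors (same L)
  ; unique    = λ L → unique (same L)
  }
  where
  open IsLimit (G-lex (F-lex lim))
  same : Cone (mapDiagram (G ∘F F) Δ) → Cone (mapDiagram G (mapDiagram F Δ))
  same L = record { apex = Cone.apex L ; leg = Cone.leg L ; commute = Cone.commute L }

module Terminal {C : Category o ℓ} {Δ : Diagram emptyGraph C} {K : Cone Δ}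
                (lim : IsLimit K) where
  open Category C
  open Cone K
  open IsLimit lim

  private
    vertex : Obj → Cone Δ
    vertex A = record { apex = A ; leg = λ () ; commute = λ () }

  ! : ∀ {A} → A ⇒ apex
  ! {A} = universal (vertex A)

  !-unique₂ : ∀ {A} {f g : A ⇒ apex} → f ≈ g
  !-unique₂ {A} {f} {g} =
    ≈.trans (unique (vertex A) f λ ()) (≈.sym (unique (vertex A) g λ ()))

inverseTransformation : {C : Category o₁ ℓ} {D : Category o₂ ℓ} {F G : Functor C D}
  (α : NaturalIsomorphism F G) → NaturalTransformation G F
inverseTransformation {C = C} {D} {F} {G} α = record
  { η = inv
  ; natural = λ {X} {Y} f → begin
      inv Y ∘ G.F₁ f                   ≈⟨ identityʳ ⟨
      (inv Y ∘ G.F₁ f) ∘ id            ≈⟨ ∘-congʳ (isoʳ X) ⟨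
      (inv Y ∘ G.F₁ f) ∘ (η X ∘ inv X) ≈⟨ assoc ⟩
      inv Y ∘ (G.F₁ f ∘ (η X ∘ inv X)) ≈⟨ ∘-congʳ assoc ⟨
      inv Y ∘ ((G.F₁ f ∘ η X) ∘ inv X) ≈⟨ ∘-congʳ (∘-congˡ (natural f)) ⟨
      inv Y ∘ ((η Y ∘ F.F₁ f) ∘ inv X) ≈⟨ ∘-congʳ assoc ⟩
      inv Y ∘ (η Y ∘ (F.F₁ f ∘ inv X)) ≈⟨ assoc ⟨
      (inv Y ∘ η Y) ∘ (F.F₁ f ∘ inv X) ≈⟨ ∘-congˡ (isoˡ Y) ⟩
      id ∘ (F.F₁ f ∘ inv X)            ≈⟨ identityˡ ⟩
      F.F₁ f ∘ inv X                   ∎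
  }
  where
  open Category D
  open ≈-Reasoning
  open NaturalIsomorphism α
  module F = Functor F
  module G = Functor G
  module _ (X : Category.Obj C) where
    open IsIso (isNaturalIso X) public

-- Families of arrows acting through a left-exact functor

module LexFunctor {C : Category o₁ ℓ} {D : Category o₂ ℓ} (C-lim : FiniteLimits C)
                  (K : Functor C D) (K-lex : PreservesFiniteLimits K) where
  private
    module C = Category C
    open module CL = FiniteLimitOps C-lim using (_⊗_; _⊗id; π₁; π₂; ⟨_,_⟩)
  open Category D
  open Functor K
  open ≈-Reasoning

  module _ {A X : C.Obj} where
    open Pairing (K-lex (Limit.isLimit (CL.product A X))) public
      using (pair; p₁∘pair; p₂∘pair; pair-unique; pair-cong; pair∘)

  private
    leg∘F₁∘ : ∀ {A B E W} {f : A C.⇒ B} {g : B C.⇒ E} {h : A C.⇒ E} {k : W ⇒ F₀ A} →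
              g C.∘ f C.≈ h → F₁ g ∘ (F₁ f ∘ k) ≈ F₁ h ∘ k
    leg∘F₁∘ p = ≈.trans (≈.sym assoc)
      (∘-congˡ (≈.trans (≈.sym homomorphism) (F-cong p)))

  F₁⊗∘pair : ∀ {A B X Y W} {u : A C.⇒ B} {v : X C.⇒ Y} {f : W ⇒ F₀ A} {g : W ⇒ F₀ X} →
             F₁ ⟨ u C.∘ π₁ , v C.∘ π₂ ⟩ ∘ pair f g ≈ pair (F₁ u ∘ f) (F₁ v ∘ g)
  F₁⊗∘pair = pair-unique
    (≈.trans (leg∘F₁∘ CL.π₁∘⟨⟩)
      (≈.trans (∘-congˡ homomorphism) (≈.trans assoc (∘-congʳ p₁∘pair))))
    (≈.trans (leg∘F₁∘ CL.π₂∘⟨⟩)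
      (≈.trans (∘-congˡ homomorphism) (≈.trans assoc (∘-congʳ p₂∘pair))))

  F₁⊗id∘pair : ∀ {A B X W} {u : A C.⇒ B} {f : W ⇒ F₀ A} {g : W ⇒ F₀ X} →
               F₁ (u ⊗id) ∘ pair f g ≈ pair (F₁ u ∘ f) g
  F₁⊗id∘pair = pair-unique
    (≈.trans (leg∘F₁∘ CL.π₁∘⟨⟩)
      (≈.trans (∘-congˡ homomorphism) (≈.trans assoc (∘-congʳ p₁∘pair))))
    (≈.trans (leg∘F₁∘ CL.π₂∘⟨⟩) p₂∘pair)

  -- An arrow `m` is a family of maps from `X` to `Y` indexed by `Z`; `q` selects a member of it.
  -- The parameter may vary over `F₀ X`; global points enter later as constant `q`.
  act : ∀ {X Y Z} → Z ⊗ X C.⇒ Y → F₀ X ⇒ F₀ Z → F₀ X ⇒ F₀ Y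
  act m q = F₁ m ∘ pair q id

  act-cong : ∀ {X Y Z} {m n : Z ⊗ X C.⇒ Y} {q r : F₀ X ⇒ F₀ Z} →
             m C.≈ n → q ≈ r → act m q ≈ act n r
  act-cong p s = ∘-cong (F-cong p) (pair-cong s ≈.refl)

  act∘ : ∀ {X Y Z W} {m : Z ⊗ X C.⇒ Y} {q : F₀ X ⇒ F₀ Z} {x : W ⇒ F₀ X} →
         act m q ∘ x ≈ F₁ m ∘ pair (q ∘ x) x
  act∘ = ≈.trans assoc (∘-congʳ (≈.trans pair∘ (pair-cong ≈.refl identityˡ)))

  act-post : ∀ {X Y Y′ Z} {f : Y C.⇒ Y′} {m : Z ⊗ X C.⇒ Y} {q : F₀ X ⇒ F₀ Z} →
             act (f C.∘ m) q ≈ F₁ f ∘ act m q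
  act-post = ≈.trans (∘-congˡ homomorphism) assoc

  act-pre : ∀ {X X′ Y Z} {f : X′ C.⇒ X} {m : Z ⊗ X C.⇒ Y} {q : F₀ X ⇒ F₀ Z} →
            act (m C.∘ ⟨ C.id C.∘ π₁ , f C.∘ π₂ ⟩) (q ∘ F₁ f) ≈ act m q ∘ F₁ f
  act-pre {f = f} {m} {q} = begin
    F₁ (m C.∘ ⟨ C.id C.∘ π₁ , f C.∘ π₂ ⟩) ∘ pair (q ∘ F₁ f) id       ≈⟨ act-post ⟩
    F₁ m ∘ (F₁ ⟨ C.id C.∘ π₁ , f C.∘ π₂ ⟩ ∘ pair (q ∘ F₁ f) id)      ≈⟨ ∘-congʳ F₁⊗∘pair ⟩
    F₁ m ∘ pair (F₁ C.id ∘ (q ∘ F₁ f)) (F₁ f ∘ id)                   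
      ≈⟨ ∘-congʳ (pair-cong (≈.trans (∘-congˡ identity) identityˡ) identityʳ) ⟩
    F₁ m ∘ pair (q ∘ F₁ f) (F₁ f)                                    ≈⟨ act∘ ⟨
    act m q ∘ F₁ f                                                   ∎

  -- Reindexing a family along `w` amounts to moving its parameter along `F₁ w`. This is the basic
  -- relation between two names of one arrow.
  act-⊗id : ∀ {X Y Z Z′} {w : Z C.⇒ Z′} {m : Z′ ⊗ X C.⇒ Y} {q : F₀ X ⇒ F₀ Z} →
            act (m C.∘ w ⊗id) q ≈ act m (F₁ w ∘ q)
  act-⊗id = ≈.trans act-post (∘-congʳ F₁⊗id∘pair)

  act-π₂ : ∀ {X Y Z} {f : X C.⇒ Y} {q : F₀ X ⇒ F₀ Z} → act (f C.∘ π₂) q ≈ F₁ f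
  act-π₂ = ≈.trans act-post (≈.trans (∘-congʳ p₂∘pair) identityʳ)

-- Naming the arrows between values of a closed functor

module Names {C : Category o₁ ℓ} {C₀ : Category o₀ ℓ}
             (C-closed : IndClosed C) (C₀-lim : FiniteLimits C₀)
             (F : Functor C C₀) (F-closed : IsClosed C-closed C₀-lim F) where
  private
    module C = Category C
    module CI = IndClosed C-closed
    open CI using (_⊗_; _⊗id; π₂; transpose)
    open module C₀L = FiniteLimitOps C₀-lim using (𝟏; π₁; ⟨_,_⟩) renaming (π₂ to ρ₂)
    module 𝟏 = Terminal (Limit.isLimit C₀L.terminal)
  open Category C₀
  open Functor F
  open IsClosed F-closed
  open LexFunctor CI.finiteLimits F preservesFiniteLimits
  open ≈-Reasoning

  act! : ∀ {X Y Z} → Z ⊗ X C.⇒ Y → 𝟏 ⇒ F₀ Z → F₀ X ⇒ F₀ Y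
  act! m p = act m (p ∘ 𝟏.!)

  record Name {X Y : C.Obj} (g : F₀ X ⇒ F₀ Y) : Set (o₁ Level.⊔ ℓ) where
    field
      parameters : C.Obj
      point      : 𝟏 ⇒ F₀ parameters
      action     : parameters ⊗ X C.⇒ Y
      names      : act! action point ≈ g

  module _ {X Y : C.Obj} where
    private
      P = CI.hom X Y
      open IndObject P using (at; tr)

      module Transpose Z = Category.IsIso
        (NaturalIsomorphism.isNaturalIso (CI.represents X Y) Z)
      module Compare = Category.IsIso (comparison-iso X Y 𝟏)

      -- At the terminal object, closedness of `F` says that global points of the ind-object
      -- `mapInd F P` correspond to arrows from `F₀ X` to `F₀ Y`, up to the factor `𝟏`.
      compare : Elem (mapInd F P) 𝟏 → 𝟏 C₀L.⊗ F₀ X ⇒ F₀ Y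
      compare a = NaturalTransformation.η
        (comparison F C-closed C₀-lim preservesFiniteLimits X Y) 𝟏 ⟨$⟩ a

    ev : ∀ i → at i ⊗ X C.⇒ Y
    ev i = transpose (i , C.id)

    ev-tr : ∀ {i j} (u : IndObject.Index._⇒_ P i j) → ev j C.∘ tr u ⊗id C.≈ ev i
    ev-tr u = C.≈.trans (C.≈.sym (natural (tr u) _))
      (Func.cong (η _) (IndHom.compatible (idᵢ {P = P}) u))
      where open NaturalIsomorphism (CI.represents X Y)

    -- The Yoneda argument: `(i , w)` is the restriction along `w` of the universal element
    -- `(i , id)`, and transposition is natural.
    transpose-ev : ∀ {Z} (a : Elem P Z) →
                   transpose a C.≈ ev (Elem.stage a) C.∘ Elem.map a ⊗id
    transpose-ev (i , w) = C.≈.trans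
      (Func.cong (η _) (sameStage {P = P} (C.≈.sym C.identityˡ))) (natural w (i , C.id))
      where open NaturalIsomorphism (CI.represents X Y)

    private
      -- As `𝟏` is terminal, the first projection equals `𝟏.! ∘ ρ₂`, so the whole comparison factors
      -- through `ρ₂`.
      compare-act! : ∀ i (p : 𝟏 ⇒ F₀ (at i)) → compare (i , p) ≈ act! (ev i) p ∘ ρ₂
      compare-act! i p = ≈.trans (∘-congʳ (pair-cong
        (≈.trans (∘-congʳ 𝟏.!-unique₂) (≈.sym assoc)) ≈.refl)) (≈.sym act∘)

    -- The inverse of the comparison sends `g ∘ ρ₂` to a point at some stage of the internal hom;
    -- composing with `⟨ 𝟏.! , id ⟩` then removes the factor `𝟏`.
    name : (g : F₀ X ⇒ F₀ Y) → Name g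
    name g with Compare.inv ⟨$⟩ (g ∘ ρ₂) | Compare.isoʳ (g ∘ ρ₂)
    ... | i , p | compare≈ = record
      { parameters = at i
      ; point      = p
      ; action     = ev i
      ; names      = begin
          act! (ev i) p                      ≈⟨ cancel ⟨
          (act! (ev i) p ∘ ρ₂) ∘ ⟨ 𝟏.! , id ⟩ ≈⟨ ∘-congˡ (compare-act! i p) ⟨
          compare (i , p) ∘ ⟨ 𝟏.! , id ⟩      ≈⟨ ∘-congˡ compare≈ ⟩
          (g ∘ ρ₂) ∘ ⟨ 𝟏.! , id ⟩             ≈⟨ cancel ⟩
          g                                  ∎
      }
      where
      cancel : ∀ {h : F₀ X ⇒ F₀ Y} → (h ∘ ρ₂) ∘ ⟨ 𝟏.! , id ⟩ ≈ h
      cancel = ≈.trans assoc (≈.trans (∘-congʳ C₀L.π₂∘⟨⟩) identityʳ)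

    classify : ∀ {Z} → Z ⊗ X C.⇒ Y → Elem P Z
    classify {Z} m = Transpose.inv Z ⟨$⟩ m

    classify-ev : ∀ {Z} (m : Z ⊗ X C.⇒ Y) →
                  m C.≈ ev (Elem.stage (classify m)) C.∘ Elem.map (classify m) ⊗id
    classify-ev {Z} m = C.≈.trans (C.≈.sym (Transpose.isoʳ Z m)) (transpose-ev (classify m))

    -- The normal form of the name `(m , p)`: its point is moved along the map classifying `m` to a
    -- stage of the internal hom.
    classify-point : ∀ {Z} → Z ⊗ X C.⇒ Y → 𝟏 ⇒ F₀ Z → Elem (mapInd F P) 𝟏
    classify-point m p = Elem.stage (classify m) , F₁ (Elem.map (classify m)) ∘ p

    act!-classify : ∀ {Z} (m : Z ⊗ X C.⇒ Y) (p : 𝟏 ⇒ F₀ Z) →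
                    act! m p ≈ act! (ev (Elem.stage (classify m)))
                                    (F₁ (Elem.map (classify m)) ∘ p)
    act!-classify m p = begin
      act! m p ≈⟨ act-cong (classify-ev m) ≈.refl ⟩
      act (ev _ C.∘ Elem.map (classify m) ⊗id) (p ∘ 𝟏.!) ≈⟨ act-⊗id ⟩
      act (ev _) (F₁ (Elem.map (classify m)) ∘ (p ∘ 𝟏.!))
        ≈⟨ act-cong C.≈.refl (≈.sym assoc) ⟩
      act! (ev _) (F₁ (Elem.map (classify m)) ∘ p) ∎

    -- Injectivity of the comparison: both normal forms have the same value under `compare`, so they
    -- are identified in the filtered colimit.
    classify-point-unique :
      ∀ {Z Z′} {m : Z ⊗ X C.⇒ Y} {m′ : Z′ ⊗ X C.⇒ Y} {p : 𝟏 ⇒ F₀ Z} {p′ : 𝟏 ⇒ F₀ Z′} →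
      act! m p ≈ act! m′ p′ → classify-point m p ∼ classify-point m′ p′
    classify-point-unique {m = m} {m′} {p} {p′} eq = ∼-trans
      (∼-sym (Compare.isoˡ _)) (∼-trans (Func.cong Compare.inv same) (Compare.isoˡ _))
      where
      same : compare (classify-point m p) ≈ compare (classify-point m′ p′)
      same = ≈.trans (compare-act! _ _) (≈.trans (∘-congˡ
        (≈.trans (≈.sym (act!-classify m p)) (≈.trans eq (act!-classify m′ p′))))
        (≈.sym (compare-act! _ _)))

-- Global points and named arrows under the left-exact functor

module Extension {C₀ : Category o₀ ℓ} {C : Category o₁ ℓ} {D : Category o₂ ℓ}
                 (C₀-closed : IndClosed C₀) (C-closed : IndClosed C)
                 (cover : InternalCover C₀-closed C-closed)
                 (D-lim : FiniteLimits D) (H : Functor C₀ D)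
                 (H-lex : PreservesFiniteLimits H) where
  private
    module C = Category C
    module C₀ = Category C₀
    module CI = IndClosed C-closed
    open CI using (_⊗_; _⊗id; π₂)
    open module C₀I = IndClosed C₀-closed using () renaming (𝟏 to 𝟏₀)
    open FiniteLimitOps D-lim using (𝟏; terminal)
    module 𝟏₀ = Terminal (Limit.isLimit C₀I.terminal)
    module 𝟏 = Terminal (Limit.isLimit terminal)
    module H𝟏₀ = Terminal (H-lex (Limit.isLimit C₀I.terminal))
    open InternalCover cover
    module F = Functor F
    module I = Functor I
    module H = Functor H
    F-lex = IsClosed.preservesFiniteLimits F-closed
    HF = H ∘F F
    module HF = Functor HF
    ΓHF = Γ D-lim ∘F HF
    module F𝟏 = Terminal (F-lex (Limit.isLimit CI.terminal))
    module LF = LexFunctor CI.finiteLimits F F-lex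
    module L = LexFunctor CI.finiteLimits HF (∘F-preservesFiniteLimits H F H-lex F-lex)
    module FI = NaturalIsomorphism F∘I≅id
    module FI⁻¹ = NaturalTransformation (inverseTransformation F∘I≅id)
  open Names C-closed C₀I.finiteLimits F F-closed
  open Category D
  open ≈-Reasoning

  -- `H` preserves the terminal object, so `H𝟏₀.!` turns the image of a global point into a global
  -- point.
  global : ∀ {A} → 𝟏₀ C₀.⇒ A → 𝟏 ⇒ H.F₀ A
  global p = H.F₁ p ∘ H𝟏₀.!

  global∘! : ∀ {A B} {p : 𝟏₀ C₀.⇒ A} → H.F₁ (p C₀.∘ 𝟏₀.! {B}) ≈ global p ∘ 𝟏.!
  global∘! = ≈.trans H.homomorphism
    (≈.trans (∘-congʳ H𝟏₀.!-unique₂) (≈.sym assoc))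

  -- `H` preserves the product of `F Z` and `F X`, so an action formed with `F` goes to the action
  -- formed with `H ∘ F` at the image point.
  H-act! : ∀ {X Y Z} {m : Z ⊗ X C.⇒ Y} {p : 𝟏₀ C₀.⇒ F.F₀ Z} →
           H.F₁ (act! m p) ≈ L.act m (global p ∘ 𝟏.!)
  H-act! = ≈.trans H.homomorphism (∘-congʳ (L.pair-unique
    (≈.trans (≈.sym H.homomorphism) (≈.trans (H.F-cong LF.p₁∘pair) global∘!))
    (≈.trans (≈.sym H.homomorphism) (≈.trans (H.F-cong LF.p₂∘pair) H.identity))))

  H-FI-cancel : ∀ A → H.F₁ (FI.η A) ∘ H.F₁ (FI⁻¹.η A) ≈ id
  H-FI-cancel A = ≈.trans (≈.sym H.homomorphism)
    (≈.trans (H.F-cong (C₀.IsIso.isoʳ (FI.isNaturalIso A))) H.identity)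

  -- Naturality of φ : F I ≅ id at φ X itself, with φ X then cancelled.
  FI-whisker : ∀ X → FI.η (F.F₀ (I.F₀ X)) C₀.≈ F.F₁ (I.F₁ (FI.η X))
  FI-whisker X = C₀.≈.trans (C₀.≈.sym cancel)
    (C₀.≈.trans (C₀.∘-congʳ (C₀.≈.sym (FI.natural (FI.η X)))) cancel)
    where
    cancel : ∀ {A} {h : A C₀.⇒ F.F₀ (I.F₀ X)} → FI⁻¹.η X C₀.∘ (FI.η X C₀.∘ h) C₀.≈ h
    cancel = C₀.≈.trans (C₀.≈.sym C₀.assoc) (C₀.≈.trans
      (C₀.∘-congˡ (C₀.IsIso.isoˡ (FI.isNaturalIso X))) C₀.identityˡ)

  -- Twisting arrows by an endomorphism of global sections

  module Twist (t : NaturalTransformation ΓHF ΓHF) where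
    open NaturalTransformation t

    -- The right-hand side of `H-act!` with the point replaced by its image under `t`.
    twist! : ∀ {X Y Z} → Z ⊗ X C.⇒ Y → 𝟏₀ C₀.⇒ F.F₀ Z → HF.F₀ X ⇒ HF.F₀ Y
    twist! {Z = Z} m p = L.act m ((η Z ⟨$⟩ global p) ∘ 𝟏.!)

    twist!-⊗id : ∀ {X Y Z Z′} {w : Z C.⇒ Z′} {m : Z′ ⊗ X C.⇒ Y} {p : 𝟏₀ C₀.⇒ F.F₀ Z} →
                 twist! (m C.∘ w ⊗id) p ≈ twist! m (F.F₁ w C₀.∘ p)
    twist!-⊗id {Z = Z} {Z′} {w} {m} {p} = ≈.trans L.act-⊗id (L.act-cong C.≈.refl
      (≈.trans (≈.sym assoc) (∘-congˡ (begin
        HF.F₁ w ∘ (η Z ⟨$⟩ global p)       ≈⟨ natural w _ ⟨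
        η Z′ ⟨$⟩ (HF.F₁ w ∘ global p)      ≈⟨ Func.cong (η Z′) assoc ⟨
        η Z′ ⟨$⟩ ((HF.F₁ w ∘ H.F₁ p) ∘ H𝟏₀.!)
          ≈⟨ Func.cong (η Z′) (∘-congˡ H.homomorphism) ⟨
        η Z′ ⟨$⟩ global (F.F₁ w C₀.∘ p)    ∎))))

    twist!-cong : ∀ {X Y Z} {m n : Z ⊗ X C.⇒ Y} {p q : 𝟏₀ C₀.⇒ F.F₀ Z} →
                  m C.≈ n → p C₀.≈ q → twist! m p ≈ twist! n q
    twist!-cong {Z = Z} r s =
      L.act-cong r (∘-congˡ (Func.cong (η Z) (∘-congˡ (H.F-cong s))))

    -- Points identified in the colimit become equal at a later stage, and passing to a later stage
    -- is a reindexing, which preserves the twist by naturality of `t`.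
    twist!-ev : ∀ {X Y} {a b : Elem (mapInd F (CI.hom X Y)) 𝟏₀} → a ∼ b →
                twist! (ev (Elem.stage a)) (Elem.map a) ≈ twist! (ev (Elem.stage b)) (Elem.map b)
    twist!-ev r = ≈.trans (later left) (≈.trans (twist!-cong C.≈.refl agree) (≈.sym (later right)))
      where
      open _∼_ r hiding (later)
      later : ∀ {X Y} {i j} {p : 𝟏₀ C₀.⇒ F.F₀ (IndObject.at (CI.hom X Y) i)}
              (u : IndObject.Index._⇒_ (CI.hom X Y) i j) →
              twist! (ev i) p ≈ twist! (ev j) (F.F₁ (IndObject.tr (CI.hom X Y) u) C₀.∘ p)
      later u = ≈.trans (twist!-cong (C.≈.sym (ev-tr u)) C₀.≈.refl) twist!-⊗id

    -- This makes the twist well defined: both names are brought to normal form, where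
    -- `classify-point-unique` relates their points.
    twist!-unique :
      ∀ {X Y Z Z′} {m : Z ⊗ X C.⇒ Y} {m′ : Z′ ⊗ X C.⇒ Y}
        {p : 𝟏₀ C₀.⇒ F.F₀ Z} {p′ : 𝟏₀ C₀.⇒ F.F₀ Z′} →
      act! m p C₀.≈ act! m′ p′ → twist! m p ≈ twist! m′ p′
    twist!-unique {m = m} {m′} {p} {p′} r = begin
      twist! m p ≈⟨ through-ev m p ⟩
      twist! (ev _) (Elem.map (classify-point m p))
        ≈⟨ twist!-ev (classify-point-unique r) ⟩
      twist! (ev _) (Elem.map (classify-point m′ p′)) ≈⟨ through-ev m′ p′ ⟨
      twist! m′ p′ ∎
      where
      through-ev : ∀ {X Y Z} (n : Z ⊗ X C.⇒ Y) (q : 𝟏₀ C₀.⇒ F.F₀ Z) →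
                   twist! n q ≈ twist! (ev _) (Elem.map (classify-point n q))
      through-ev n q = ≈.trans (twist!-cong (classify-ev n) C₀.≈.refl) twist!-⊗id

    twist : ∀ {X Y} → F.F₀ X C₀.⇒ F.F₀ Y → HF.F₀ X ⇒ HF.F₀ Y
    twist g = twist! action point
      where open Name (name g)

    -- The twist can be computed from any name, so each law below follows by exhibiting a convenient
    -- one.
    twist-unique : ∀ {X Y Z} {g : F.F₀ X C₀.⇒ F.F₀ Y} {m : Z ⊗ X C.⇒ Y} {p : 𝟏₀ C₀.⇒ F.F₀ Z} →
                   act! m p C₀.≈ g → twist g ≈ twist! m p
    twist-unique {g = g} r = twist!-unique (C₀.≈.trans names (C₀.≈.sym r))
      where open Name (name g)

    twist-cong : ∀ {X Y} {g h : F.F₀ X C₀.⇒ F.F₀ Y} → g C₀.≈ h → twist g ≈ twist h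
    twist-cong {h = h} r = twist-unique (C₀.≈.trans names (C₀.≈.sym r))
      where open Name (name h)

    twist-F₁ : ∀ {X Y} (f : X C.⇒ Y) → twist (F.F₁ f) ≈ HF.F₁ f
    -- The name is the constant family `f` over the terminal object of `C`; its action does not
    -- depend on the point that `t` moves.
    twist-F₁ f = ≈.trans (twist-unique {m = f C.∘ π₂} {p = F𝟏.!} LF.act-π₂) L.act-π₂

    -- Here and in `twist-pre`, composing the action with an arrow of `C` names the composite with
    -- the same point.
    twist-post : ∀ {X Y Y′} (f : Y C.⇒ Y′) (g : F.F₀ X C₀.⇒ F.F₀ Y) →
                 twist (F.F₁ f C₀.∘ g) ≈ HF.F₁ f ∘ twist g
    twist-post f g = ≈.trans
      (twist-unique (C₀.≈.trans LF.act-post (C₀.∘-congʳ names))) L.act-post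
      where open Name (name g)

    twist-pre : ∀ {X X′ Y} (g : F.F₀ X C₀.⇒ F.F₀ Y) (f : X′ C.⇒ X) →
                twist (g C₀.∘ F.F₁ f) ≈ twist g ∘ HF.F₁ f
    twist-pre g f = ≈.trans
      (twist-unique (C₀.≈.trans
        (LF.act-cong C.≈.refl (C₀.≈.trans (C₀.∘-congʳ 𝟏₀.!-unique₂) (C₀.≈.sym C₀.assoc)))
        (C₀.≈.trans LF.act-pre (C₀.∘-congˡ names))))
      (≈.trans
        (L.act-cong C.≈.refl (≈.trans (∘-congʳ 𝟏.!-unique₂) (≈.sym assoc))) L.act-pre)
      where open Name (name g)

    -- Naturality at the two projections determines `t` on a pair.
    η-pair : ∀ {A X} (a : 𝟏 ⇒ HF.F₀ A) (x : 𝟏 ⇒ HF.F₀ X) →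
             η (A ⊗ X) ⟨$⟩ L.pair a x ≈ L.pair (η A ⟨$⟩ a) (η X ⟨$⟩ x)
    η-pair {A} {X} a x = L.pair-unique
      (≈.trans (≈.sym (natural _ _)) (Func.cong (η A) L.p₁∘pair))
      (≈.trans (≈.sym (natural _ _)) (Func.cong (η X) L.p₂∘pair))

    -- As `x` is fixed, moving the point alone is the same as applying `t` to the pair of the point
    -- and `x`; naturality at the action then pulls `t` out.
    twist∘fixed : ∀ {X Y} (g : F.F₀ X C₀.⇒ F.F₀ Y) {x : 𝟏 ⇒ HF.F₀ X} →
                  η X ⟨$⟩ x ≈ x → twist g ∘ x ≈ η Y ⟨$⟩ (H.F₁ g ∘ x)
    twist∘fixed {X} {Y} g {x} x-fixed = begin
      twist g ∘ x ≈⟨ L.act∘ ⟩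
      HF.F₁ action ∘ L.pair (((η Z ⟨$⟩ global point) ∘ 𝟏.!) ∘ x) x
        ≈⟨ ∘-congʳ (L.pair-cong cancel! (≈.sym x-fixed)) ⟩
      HF.F₁ action ∘ L.pair (η Z ⟨$⟩ global point) (η X ⟨$⟩ x) ≈⟨ ∘-congʳ (η-pair _ _) ⟨
      HF.F₁ action ∘ (η (Z ⊗ X) ⟨$⟩ L.pair (global point) x)   ≈⟨ natural action _ ⟨
      η Y ⟨$⟩ (HF.F₁ action ∘ L.pair (global point) x)
        ≈⟨ Func.cong (η Y) (∘-congʳ (L.pair-cong cancel! ≈.refl)) ⟨
      η Y ⟨$⟩ (HF.F₁ action ∘ L.pair ((global point ∘ 𝟏.!) ∘ x) x)
        ≈⟨ Func.cong (η Y) L.act∘ ⟨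
      η Y ⟨$⟩ (L.act action (global point ∘ 𝟏.!) ∘ x)
        ≈⟨ Func.cong (η Y) (∘-congˡ H-act!) ⟨
      η Y ⟨$⟩ (H.F₁ (act! action point) ∘ x)
        ≈⟨ Func.cong (η Y) (∘-congˡ (H.F-cong names)) ⟩
      η Y ⟨$⟩ (H.F₁ g ∘ x) ∎
      where
      open Name (name g) renaming (parameters to Z)
      cancel! : ∀ {A} {a : 𝟏 ⇒ A} → (a ∘ 𝟏.!) ∘ x ≈ a
      cancel! = ≈.trans assoc (≈.trans (∘-congʳ 𝟏.!-unique₂) identityʳ)

    -- Extending the endomorphism from global sections to `H ∘ F`

    extend : NaturalTransformation HF HF
    extend = record
      { η = λ X → twist (FI.η (F.F₀ X)) ∘ H.F₁ (FI⁻¹.η (F.F₀ X))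
      ; natural = λ {X} {Y} f → begin
          (twist (FI.η (F.F₀ Y)) ∘ H.F₁ (FI⁻¹.η (F.F₀ Y))) ∘ HF.F₁ f ≈⟨ assoc ⟩
          twist (FI.η (F.F₀ Y)) ∘ (H.F₁ (FI⁻¹.η (F.F₀ Y)) ∘ HF.F₁ f)
            ≈⟨ ∘-congʳ (≈.trans (≈.sym H.homomorphism)
                 (≈.trans (H.F-cong (FI⁻¹.natural (F.F₁ f))) H.homomorphism)) ⟩
          twist (FI.η (F.F₀ Y)) ∘ (HF.F₁ (I.F₁ (F.F₁ f)) ∘ H.F₁ (FI⁻¹.η (F.F₀ X)))
            ≈⟨ assoc ⟨
          (twist (FI.η (F.F₀ Y)) ∘ HF.F₁ (I.F₁ (F.F₁ f))) ∘ H.F₁ (FI⁻¹.η (F.F₀ X))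
            -- The naturality square of `F∘I≅id` at `F.F₁ f` is twisted as a whole; its sides
            -- `F.F₁ (I.F₁ (F.F₁ f))` and `F.F₁ f` come from `C`, so they pass through the twist.
            ≈⟨ ∘-congˡ (≈.trans (≈.sym (twist-pre _ _))
                 (≈.trans (twist-cong (FI.natural (F.F₁ f))) (twist-post _ _))) ⟩
          (HF.F₁ f ∘ twist (FI.η (F.F₀ X))) ∘ H.F₁ (FI⁻¹.η (F.F₀ X)) ≈⟨ assoc ⟩
          HF.F₁ f ∘ (twist (FI.η (F.F₀ X)) ∘ H.F₁ (FI⁻¹.η (F.F₀ X))) ∎
      }

    -- At `I X` the arrow being twisted is itself the image under `F` of an arrow of `C`, by
    -- `FI-whisker`, so the twist leaves it unchanged and it cancels against its inverse.
    extend-fixes : ∀ X → NaturalTransformation.η extend (I.F₀ X) ≈ id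
    extend-fixes X = ≈.trans (∘-congˡ (≈.trans (twist-cong (FI-whisker X))
      (≈.trans (twist-F₁ _) (H.F-cong (C₀.≈.sym (FI-whisker X)))))) (H-FI-cancel _)

    -- Transporting `x` along `H.F₁ φ⁻¹` gives a global point over an object in the image of `I`,
    -- which `t` fixes, so `twist∘fixed` applies.
    Γ-extend : (∀ X x → η (I.F₀ X) ⟨$⟩ x ≈ x) →
               ∀ X x → NaturalTransformation.η extend X ∘ x ≈ η X ⟨$⟩ x
    Γ-extend fixed X x = begin
      (twist φ ∘ H.F₁ φ⁻¹) ∘ x ≈⟨ assoc ⟩
      twist φ ∘ (H.F₁ φ⁻¹ ∘ x) ≈⟨ twist∘fixed φ (fixed (F.F₀ X) _) ⟩
      η X ⟨$⟩ (H.F₁ φ ∘ (H.F₁ φ⁻¹ ∘ x))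
        ≈⟨ Func.cong (η X) (≈.trans (≈.sym assoc)
             (≈.trans (∘-congˡ (H-FI-cancel _)) identityˡ)) ⟩
      η X ⟨$⟩ x ∎
      where
      φ   = FI.η (F.F₀ X)
      φ⁻¹ = FI⁻¹.η (F.F₀ X)

  -- Faithfulness on global sections

  module _ (τ : NaturalTransformation HF HF) where
    open NaturalTransformation τ

    -- Naturality at `m` moves `τ` to `Z ⊗ X`, where it acts componentwise; being the identity at
    -- `X`, it affects the point alone.
    η-act! : ∀ {X Y Z} (m : Z ⊗ X C.⇒ Y) (p : 𝟏₀ C₀.⇒ F.F₀ Z) → η X ≈ id →
             η Y ∘ H.F₁ (act! m p) ≈ L.act m ((η Z ∘ global p) ∘ 𝟏.!)
    η-act! {X} {Y} {Z} m p fixed = begin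
      η Y ∘ H.F₁ (act! m p) ≈⟨ ∘-congʳ H-act! ⟩
      η Y ∘ (HF.F₁ m ∘ L.pair (global p ∘ 𝟏.!) id) ≈⟨ assoc ⟨
      (η Y ∘ HF.F₁ m) ∘ L.pair (global p ∘ 𝟏.!) id ≈⟨ ∘-congˡ (natural m) ⟩
      (HF.F₁ m ∘ η (Z ⊗ X)) ∘ L.pair (global p ∘ 𝟏.!) id ≈⟨ assoc ⟩
      HF.F₁ m ∘ (η (Z ⊗ X) ∘ L.pair (global p ∘ 𝟏.!) id) ≈⟨ ∘-congʳ (L.pair-unique
        (≈.trans (≈.sym assoc) (≈.trans (∘-congˡ (≈.sym (natural _))) (≈.trans assoc
          (≈.trans (∘-congʳ L.p₁∘pair) (≈.sym assoc)))))
        (≈.trans (≈.sym assoc) (≈.trans (∘-congˡ (≈.sym (natural _))) (≈.trans assoc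
          (≈.trans (∘-congʳ L.p₂∘pair) (≈.trans identityʳ fixed)))))) ⟩
      L.act m ((η Z ∘ global p) ∘ 𝟏.!) ∎

  -- Both transformations are the identity at `I (F X)`, so after the named arrow `φ` from `F I F X`
  -- to `F X` each is determined by its effect on one global point; `H.F₁ φ` is then cancelled.
  -- Treating endomorphisms lets this also prove extensions invertible.
  Γ-faithful : (σ τ : NaturalTransformation HF HF) →
    let module σ = NaturalTransformation σ
        module τ = NaturalTransformation τ in
    (∀ X → σ.η (I.F₀ X) ≈ id) → (∀ X → τ.η (I.F₀ X) ≈ id) →
    (∀ X (x : 𝟏 ⇒ HF.F₀ X) → σ.η X ∘ x ≈ τ.η X ∘ x) → ∀ X → σ.η X ≈ τ.η X
  Γ-faithful σ τ σ-fixes τ-fixes same X = begin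
    σ.η X ≈⟨ cancel ⟨
    (σ.η X ∘ H.F₁ φ) ∘ H.F₁ φ⁻¹ ≈⟨ ∘-congˡ (begin
      σ.η X ∘ H.F₁ φ ≈⟨ ∘-congʳ (H.F-cong names) ⟨
      σ.η X ∘ H.F₁ (act! action point) ≈⟨ η-act! σ action point (σ-fixes (F.F₀ X)) ⟩
      L.act action ((σ.η parameters ∘ global point) ∘ 𝟏.!)
        ≈⟨ L.act-cong C.≈.refl (∘-congˡ (same parameters (global point))) ⟩
      L.act action ((τ.η parameters ∘ global point) ∘ 𝟏.!)
        ≈⟨ η-act! τ action point (τ-fixes (F.F₀ X)) ⟨
      τ.η X ∘ H.F₁ (act! action point) ≈⟨ ∘-congʳ (H.F-cong names) ⟩
      τ.η X ∘ H.F₁ φ ∎) ⟩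
    (τ.η X ∘ H.F₁ φ) ∘ H.F₁ φ⁻¹ ≈⟨ cancel ⟩
    τ.η X ∎
    where
    module σ = NaturalTransformation σ
    module τ = NaturalTransformation τ
    φ   = FI.η (F.F₀ X)
    φ⁻¹ = FI⁻¹.η (F.F₀ X)
    open Name (name {X = I.F₀ (F.F₀ X)} {Y = X} φ)
    cancel : ∀ {B} {h : HF.F₀ X ⇒ B} → (h ∘ H.F₁ φ) ∘ H.F₁ φ⁻¹ ≈ h
    cancel = ≈.trans assoc (≈.trans (∘-congʳ (H-FI-cancel _)) identityʳ)

-- Injectivity by faithfulness, surjectivity by extension

theorem4p12 : {o₀ o₁ o₂ ℓ : Level}
    {C₀ : Category o₀ ℓ} {C : Category o₁ ℓ} {D : Category o₂ ℓ} →
    EssentiallySmall C₀ → EssentiallySmall C → EssentiallySmall D →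
    (C₀-closed : IndClosed C₀) (C-closed : IndClosed C)
    (cover : InternalCover C₀-closed C-closed)
    (D-lim : FiniteLimits D)
    (H : Functor C₀ D) → PreservesFiniteLimits H →
    let open InternalCover cover in
    GroupMorphisms.IsGroupIsomorphism
    (Group.rawGroup (Aut (H ∘F F) I))
    (Group.rawGroup (Aut (Γ D-lim ∘F (H ∘F F)) I))
    (applyFunctor (Γ D-lim))
theorem4p12 {D = D} _ _ _ C₀-closed C-closed cover D-lim H H-lex = record
  { isGroupMonomorphism = record
      { isGroupHomomorphism = record
          { isMonoidHomomorphism = record
              { isMagmaHomomorphism = record
                  { isRelHomomorphism = record { cong = λ p X x → ∘-congˡ (p X) }
                  ; homo = λ _ _ _ _ → assoc
                  }
              ; ε-homo = λ _ _ → identityˡ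
              }
          ; ⁻¹-homo = λ _ _ _ → ≈.refl
          }
      ; injective = λ {s} {t} →
          Γ-faithful (transformation s) (transformation t) (fixes s) (fixes t)
      }
  -- Surjectivity is demanded for every `s` equal to the extension of `t`, hence the passage through
  -- `s≈`.
  ; surjective = λ t → extendAut t , λ {s} s≈ X x →
      ≈.trans (∘-congˡ (s≈ X)) (Γ-extend (transformation t) (fixes t) X x)
  }
  where
  open Category D
  open InternalCover cover
  open Extension C₀-closed C-closed cover D-lim H H-lex
  open Twist
  open AutOver
  open Group (Aut (Γ D-lim ∘F (H ∘F F)) I) using (_⁻¹)
  module End (t : AutOver (Γ D-lim ∘F (H ∘F F)) I) =
    NaturalTransformation (extend (transformation t))

  -- No iterated twist is computed: the composite of the extensions and the identity both fix the
  -- image of `I` and agree on global sections, so faithfulness identifies them.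
  inverse : ∀ s t → (∀ X x → η s X ⟨$⟩ (η t X ⟨$⟩ x) ≈ x) →
            ∀ X → End.η s X ∘ End.η t X ≈ id
  inverse s t st≈id = Γ-faithful
    (record
      { η = λ X → End.η s X ∘ End.η t X
      ; natural = λ f → ≈.trans assoc (≈.trans (∘-congʳ (End.natural t f))
          (≈.trans (≈.sym assoc) (≈.trans (∘-congˡ (End.natural s f)) assoc)))
      })
    (record { η = λ _ → id ; natural = λ _ → ≈.trans identityˡ (≈.sym identityʳ) })
    (λ X → ≈.trans
      (∘-cong (extend-fixes (transformation s) X) (extend-fixes (transformation t) X))
      identityˡ)
    (λ _ → ≈.refl)
    (λ X x → ≈.trans assoc (≈.trans (∘-congʳ (Γ-extend (transformation t) (fixes t) X x))
      (≈.trans (Γ-extend (transformation s) (fixes s) X _)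
        (≈.trans (st≈id X x) (≈.sym identityˡ)))))

  extendAut : AutOver (Γ D-lim ∘F (H ∘F F)) I → AutOver (H ∘F F) I
  extendAut t = record
    { automorphism = record
        { transformation = extend (transformation t)
        ; isNaturalIso   = λ X → record
            { inv  = End.η (t ⁻¹) X
            ; isoˡ = inverse (t ⁻¹) t (Iso.isoˡ t) X
            ; isoʳ = inverse t (t ⁻¹) (Iso.isoʳ t) X
            }
        }
    ; fixes = extend-fixes (transformation t)
    }
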